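{- For all positive integers $n$ and $m$, the Pancake graphs satisfy $\chi(P_{n+m})\leqslant\chi(P_n)+\chi(P_m)$.
   Context: For $n\geqslant 1$, the Pancake graph $P_n$ is the Cayley graph on the symmetric group $\mathrm{Sym}_n$, with permutations written in one-line notation $\pi=[\pi_1\pi_2\ldots\pi_n]$. Its generating set consists of the prefix-reversals $r_i$, $2\leqslant i\leqslant n$. Multiplying $\pi$ on the right by $r_i$ reverses the first $i$ entries: $\pi r_i=[\pi_i\pi_{i-1}\ldots\pi_1\pi_{i+1}\ldots\pi_n]$. Two vertices $\pi,\sigma$ are adjacent iff $\sigma=\pi r_i$ for some $2\leqslant i\leqslant n$. In particular $P_1$ is a single vertex. $\chi$ denotes the chromatic number. -}

module Defs where

open import Data.Fin.Base
  using (Fin; zero; suc; toℕ; fromℕ<; inject≤; opposite; combine; remQuot;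
         finToFun; funToFin; punchIn)
import Data.Fin.Properties as Fin
open import Data.Fin.Permutation as Perm
  using (Permutation′; _⟨$⟩ʳ_; _∘ₚ_; permutation; insert; remove)
open import Data.Nat.Base
  using (ℕ; zero; suc; _+_; _∸_; _≤_; _<_; _!; z≤n; s≤s)
import Data.Nat.Properties as ℕ
open import Data.Product.Base using (Σ-syntax; ∃; ∃-syntax; _×_; _,_; proj₁; proj₂)
open import Function.Base using (_∘_)
open import Function.Bundles using (Func; Inverse; Injection)
open import Function.Properties.Inverse using (↔⇒↣)
open import Level using (0ℓ)
open import Relation.Binary.Bundles using (Setoid)
open import Relation.Binary.Core using (Rel)
open import Relation.Binary.Definitions
  using (Symmetric; Irreflexive; Decidable; _Respects₂_)
open import Relation.Binary.PropositionalEquality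
  using (_≡_; _≢_; refl; sym; trans; cong; cong₂; subst; setoid; module ≡-Reasoning)
open import Relation.Nullary using (Dec; yes; no; ¬_; contradiction)
open import Relation.Nullary.Decidable using (map′; _×-dec_; _→-dec_; ¬?)

-- Vertices form a setoid so that permutations can be compared pointwise.
record FiniteGraph : Set₁ where
  field
    vertices    : Setoid 0ℓ 0ℓ
    order       : ℕ
    enumeration : Inverse vertices (setoid (Fin order))

  open Setoid vertices public using (_≈_) renaming (Carrier to Vertex)

  field
    Adj        : Rel Vertex 0ℓ
    adj-resp-≈ : Adj Respects₂ _≈_
    adj-sym    : Symmetric Adj
    adj-irrefl : Irreflexive _≈_ Adj
    adj?       : Decidable Adj

record Colouring (G : FiniteGraph) (k : ℕ) : Set where
  open FiniteGraph G
  field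
    colour : Func vertices (setoid (Fin k))

  open Func colour public renaming (to to colourOf; cong to colourOf-cong)

  field
    proper : ∀ {u v} → Adj u v → colourOf u ≢ colourOf v

IsChromaticNumber : FiniteGraph → ℕ → Set
IsChromaticNumber G k = Colouring G k × (∀ j → Colouring G j → k ≤ j)

module _ (G : FiniteGraph) where
  open FiniteGraph G
  open Setoid vertices using () renaming (sym to ≈-sym; trans to ≈-trans)
  open Inverse enumeration renaming (to to index; from to vertex; to-cong to index-cong)

  private
    index-vertex : ∀ i → index (vertex i) ≡ i
    index-vertex = strictlyInverseˡ

    vertex-index : ∀ v → vertex (index v) ≈ v
    vertex-index = strictlyInverseʳ

    Proper : ∀ {k} → (Fin order → Fin k) → Set
    Proper c = ∀ i j → Adj (vertex i) (vertex j) → c i ≢ c j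

    proper? : ∀ {k} (c : Fin order → Fin k) → Dec (Proper c)
    proper? c = Fin.all? λ i → Fin.all? λ j →
      adj? (vertex i) (vertex j) →-dec ¬? (c i Fin.≟ c j)

    fromProper : ∀ {k} (c : Fin order → Fin k) → Proper c → Colouring G k
    fromProper c p = record
      { colour = record { to = c ∘ index ; cong = cong c ∘ index-cong }
      ; proper = λ {u} {v} uv → p (index u) (index v)
          (proj₁ adj-resp-≈ (≈-sym (vertex-index v))
            (proj₂ adj-resp-≈ (≈-sym (vertex-index u)) uv))
      }

    toProper : ∀ {k} → Colouring G k →
               ∃[ x ] Proper (finToFun {k} {order} x)
    toProper {k} C = funToFin c , λ i j ij eq → proper ij
      (trans (sym (Fin.finToFun-funToFin c i))
        (trans eq (Fin.finToFun-funToFin c j)))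
      where
      open Colouring C
      c : Fin order → Fin k
      c = colourOf ∘ vertex

  colouring? : ∀ k → Dec (Colouring G k)
  colouring? k = map′ (λ (x , p) → fromProper (finToFun x) p) toProper
    (Fin.any? λ x → proper? (finToFun {k} {order} x))

  trivialColouring : Colouring G order
  trivialColouring = fromProper (λ i → i) λ { i .i ii refl →
    adj-irrefl (Setoid.refl vertices) ii }

  private
    leastFrom : ∀ d k → Colouring G (d + k) →
                (∀ j → Colouring G j → k ≤ j) →
                ∃ (IsChromaticNumber G)
    leastFrom zero    k C lb = k , C , lb
    leastFrom (suc d) k C lb with colouring? k
    ... | yes C′ = k , C′ , lb
    ... | no ¬C  = leastFrom d (suc k) (subst (Colouring G) (sym (ℕ.+-suc d k)) C)
      λ j D → ℕ.≤∧≢⇒< (lb j D) λ { refl → ¬C D }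

  chromaticNumber : ∃ (IsChromaticNumber G)
  chromaticNumber = leastFrom order 0
    (subst (Colouring G) (sym (ℕ.+-identityʳ order)) trivialColouring) λ _ _ → z≤n

  χ : ℕ
  χ = proj₁ chromaticNumber

  χ-isChromaticNumber : IsChromaticNumber G χ
  χ-isChromaticNumber = proj₂ chromaticNumber

Sym : ℕ → Setoid 0ℓ 0ℓ
Sym n = record
  { Carrier       = Permutation′ n
  ; _≈_           = Perm._≈_
  ; isEquivalence = record
    { refl  = λ _ → refl
    ; sym   = λ e i → sym (e i)
    ; trans = λ e f i → trans (e i) (f i)
    }
  }

-- The entries of π ∙ ρ in one-line notation are π ⟨$⟩ʳ (ρ ⟨$⟩ʳ j);
-- the library's _∘ₚ_ composes in diagrammatic order.
infixl 7 _∙_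
_∙_ : ∀ {n} → Permutation′ n → Permutation′ n → Permutation′ n
π ∙ ρ = ρ ∘ₚ π

private
  code : ∀ n → Permutation′ n → Fin (n !)
  code zero    π = zero
  code (suc n) π = combine (π ⟨$⟩ʳ zero) (code n (remove zero π))

  decode′ : ∀ n → Fin (suc n) × Fin (n !) → Permutation′ (suc n)
  decode : ∀ n → Fin (n !) → Permutation′ n
  decode zero    _ = Perm.id
  decode (suc n) x = decode′ n (remQuot (n !) x)
  decode′ n (i , y) = insert zero i (decode n y)

  remove-cong : ∀ {n} (π ρ : Permutation′ (suc n)) → π Perm.≈ ρ →
                remove zero π Perm.≈ remove zero ρ
  remove-cong π ρ e k = Fin.punchIn-injective (π ⟨$⟩ʳ zero) _ _ (begin
    punchIn (π ⟨$⟩ʳ zero) (remove zero π ⟨$⟩ʳ k) ≡⟨ Perm.punchIn-permute π zero k ⟨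
    π ⟨$⟩ʳ suc k                                     ≡⟨ e (suc k) ⟩
    ρ ⟨$⟩ʳ suc k                                     ≡⟨ Perm.punchIn-permute ρ zero k ⟩
    punchIn (ρ ⟨$⟩ʳ zero) (remove zero ρ ⟨$⟩ʳ k)
      ≡⟨ cong (λ z → punchIn z (remove zero ρ ⟨$⟩ʳ k)) (e zero) ⟨
    punchIn (π ⟨$⟩ʳ zero) (remove zero ρ ⟨$⟩ʳ k) ∎)
    where open ≡-Reasoning

  insert-cong : ∀ {n} i (π ρ : Permutation′ n) → π Perm.≈ ρ →
                insert zero i π Perm.≈ insert zero i ρ
  insert-cong i π ρ e zero    = refl
  insert-cong i π ρ e (suc k) = cong (punchIn i) (e k)

  code-cong : ∀ n {π ρ} → π Perm.≈ ρ → code n π ≡ code n ρ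
  code-cong zero    e = refl
  code-cong (suc n) {π} {ρ} e =
    cong₂ combine (e zero) (code-cong n (remove-cong π ρ e))

  code-decode : ∀ n x → code n (decode n x) ≡ x
  code-decode zero    zero = refl
  code-decode (suc n) x    = trans
    (cong (combine i) (trans
      (code-cong n (Perm.remove-insert zero i (decode n y)))
      (code-decode n y)))
    (Fin.combine-remQuot {suc n} (n !) x)
    where
    i = proj₁ (remQuot {suc n} (n !) x)
    y = proj₂ (remQuot {suc n} (n !) x)

  decode-code : ∀ n π → decode n (code n π) Perm.≈ π
  decode-code (suc n) π k = begin
    decode′ n (remQuot (n !) (combine i (code n ρ))) ⟨$⟩ʳ k
      ≡⟨ cong (λ p → decode′ n p ⟨$⟩ʳ k) (Fin.remQuot-combine i (code n ρ)) ⟩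
    insert zero i (decode n (code n ρ)) ⟨$⟩ʳ k
      ≡⟨ insert-cong i (decode n (code n ρ)) ρ (decode-code n ρ) k ⟩
    insert zero i ρ ⟨$⟩ʳ k
      ≡⟨ Perm.insert-remove zero π k ⟩
    π ⟨$⟩ʳ k ∎
    where
    open ≡-Reasoning
    i = π ⟨$⟩ʳ zero
    ρ = remove zero π

Sym-enumeration : ∀ n → Inverse (Sym n) (setoid (Fin (n !)))
Sym-enumeration n = record
  { to        = code n
  ; from      = decode n
  ; to-cong   = code-cong n
  ; from-cong = λ { refl _ → refl }
  ; inverse   = (λ {x} e → trans (code-cong n e) (code-decode n x))
              , (λ { {π} refl → decode-code n π })
  }

-- Positions are counted from 0, so the first i positions are those j with
-- toℕ j < i, and such a j is sent to i - 1 - j.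
reversePrefix : ∀ {n} i → .(i ≤ n) → Fin n → Fin n
reversePrefix i i≤n j with toℕ j ℕ.<? i
... | yes j<i = inject≤ (opposite (fromℕ< j<i)) i≤n
... | no  _   = j

private
  toℕ-reversePrefix : ∀ {n} i .(i≤n : i ≤ n) j → toℕ j < i →
                      toℕ (reversePrefix i i≤n j) ≡ i ∸ suc (toℕ j)
  toℕ-reversePrefix i i≤n j j<i with toℕ j ℕ.<? i
  ... | no ≮   = contradiction j<i ≮
  ... | yes lt = trans (Fin.toℕ-inject≤ (opposite (fromℕ< lt)) i≤n)
    (trans (Fin.opposite-prop (fromℕ< lt))
      (cong (λ z → i ∸ suc z) (Fin.toℕ-fromℕ< lt)))

  reversePrefix-≮ : ∀ {n} i .(i≤n : i ≤ n) j → ¬ (toℕ j < i) →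
                    reversePrefix i i≤n j ≡ j
  reversePrefix-≮ i i≤n j ≮ with toℕ j ℕ.<? i
  ... | yes lt = contradiction lt ≮
  ... | no _   = refl

  ∸-suc-< : ∀ {i a} → a < i → i ∸ suc a < i
  ∸-suc-< {suc i} {a} _ = s≤s (ℕ.m∸n≤m i a)

  ∸-suc-involutive : ∀ {i a} → a < i → i ∸ suc (i ∸ suc a) ≡ a
  ∸-suc-involutive {suc i} {a} (s≤s a≤i) = ℕ.m∸[m∸n]≡n a≤i

reversePrefix-involutive : ∀ {n} i .(i≤n : i ≤ n) j →
  reversePrefix i i≤n (reversePrefix i i≤n j) ≡ j
reversePrefix-involutive i i≤n j = go (toℕ j ℕ.<? i)
  where
  r = reversePrefix i i≤n
  go : Dec (toℕ j < i) → r (r j) ≡ j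
  go (no ≮)   = trans (cong r (reversePrefix-≮ i i≤n j ≮)) (reversePrefix-≮ i i≤n j ≮)
  go (yes lt) = Fin.toℕ-injective (trans
    (toℕ-reversePrefix i i≤n (r j) (subst (_< i) (sym eq) (∸-suc-< lt)))
    (trans (cong (λ z → i ∸ suc z) eq) (∸-suc-involutive lt)))
    where
    eq : toℕ (r j) ≡ i ∸ suc (toℕ j)
    eq = toℕ-reversePrefix i i≤n j lt

prefixReversal : ∀ {n} i → .(i ≤ n) → Permutation′ n
prefixReversal i i≤n = permutation (reversePrefix i i≤n) (reversePrefix i i≤n)
  (reversePrefix-involutive i i≤n) (reversePrefix-involutive i i≤n)

PancakeAdj : ∀ {n} → Rel (Permutation′ n) 0ℓ
PancakeAdj {n} π σ =
  ∃[ i ] 2 ≤ i × Σ[ i≤n ∈ i ≤ n ] σ Perm.≈ π ∙ prefixReversal i i≤n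

private
  pancake-sym : ∀ {n} → Symmetric (PancakeAdj {n})
  pancake-sym {n} {π} {σ} (i , 2≤i , i≤n , e) = i , 2≤i , i≤n , λ j →
    trans (cong (π ⟨$⟩ʳ_) (sym (reversePrefix-involutive i i≤n j)))
      (sym (e (reversePrefix i i≤n j)))

  reversePrefix-moves : ∀ {n} i (i≤n : i ≤ n) → 2 ≤ i →
                        ∃[ j ] reversePrefix i i≤n j ≢ j
  reversePrefix-moves {suc n} (suc (suc i)) i≤n _ = zero , λ e →
    ℕ.1+n≢0 (trans (sym (toℕ-reversePrefix (suc (suc i)) i≤n zero (s≤s z≤n))) (cong toℕ e))
  reversePrefix-moves {zero} (suc _) ()
  reversePrefix-moves (suc zero) _ (s≤s ())

  pancake-irrefl : ∀ {n} → Irreflexive Perm._≈_ (PancakeAdj {n})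
  pancake-irrefl {n} {π} {σ} π≈σ (i , 2≤i , i≤n , e) =
    let j , moved = reversePrefix-moves i i≤n 2≤i in
    moved (sym (Injection.injective (↔⇒↣ π) (trans (π≈σ j) (e j))))

  pancake? : ∀ {n} → Decidable (PancakeAdj {n})
  pancake? {n} π σ = map′
    (λ { (i , _ , p) → i , p })
    (λ { (i , 2≤i , i≤n , e) → i , s≤s i≤n , 2≤i , i≤n , e })
    (ℕ.anyUpTo? P? (suc n))
    where
    P? : ∀ i → Dec (2 ≤ i × Σ[ i≤n ∈ i ≤ n ] σ Perm.≈ π ∙ prefixReversal i i≤n)
    P? i with i ℕ.≤? n
    ... | no ≰    = no λ { (_ , i≤n , _) → ≰ i≤n }
    ... | yes i≤n = (2 ℕ.≤? i) ×-dec map′ (i≤n ,_) proj₂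
      (Fin.all? λ j → (σ ⟨$⟩ʳ j) Fin.≟ ((π ∙ prefixReversal i i≤n) ⟨$⟩ʳ j))

-- P 0, like P 1, is a single vertex.
P : ℕ → FiniteGraph
P n = record
  { vertices    = Sym n
  ; order       = n !
  ; enumeration = Sym-enumeration n
  ; Adj         = PancakeAdj
  ; adj-resp-≈  =
      (λ { σ≈τ (i , 2≤i , i≤n , e) → i , 2≤i , i≤n , λ j → trans (sym (σ≈τ j)) (e j) })
    , (λ { π≈ρ (i , 2≤i , i≤n , e) → i , 2≤i , i≤n , λ j →
           trans (e j) (π≈ρ (reversePrefix i i≤n j)) })
  ; adj-sym     = λ {π} {σ} → pancake-sym {n} {π} {σ}
  ; adj-irrefl  = λ {π} {σ} → pancake-irrefl {n} {π} {σ}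
  ; adj?        = pancake?
  }

{-# OPTIONS --safe #-}

-- Colour a permutation of n + m letters according to whether its first letter
-- is one of the first n (small) or one of the last m (large). If it is small,
-- erase the large letters and colour the remaining word by an optimal colouring
-- of P n; if it is large, erase the small letters and use P m with fresh
-- colours. A prefix reversal preserving the class of the first letter induces a
-- prefix reversal of the remaining word, whose length is at least 2 because the
-- reversed prefix begins and ends with distinct letters of that class.
module Submission where

open import Defs
import Algebra.Properties.CommutativeMonoid.Sum
open import Data.Bool.Base using (if_then_else_)
open import Data.Fin.Base
  using (Fin; zero; suc; toℕ; fromℕ<; inject≤; opposite; punchOut; splitAt; join; _↑ˡ_; _↑ʳ_)
import Data.Fin.Properties as Fin
open import Data.Fin.Permutation as Perm
  using (Permutation′; _⟨$⟩ʳ_; _⟨$⟩ˡ_; permutation; flip)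
open import Data.Nat.Base using (ℕ; zero; suc; _+_; _∸_; _≤_; _<_; NonZero; z≤n; s≤s)
import Data.Nat.Properties as ℕ
open import Data.Product.Base using (∃; _×_; _,_; proj₁; proj₂)
open import Data.Sum.Base as Sum using (_⊎_; inj₁; inj₂)
open import Data.Sum.Properties using (inj₁-injective; inj₂-injective)
open import Function.Base using (_∘_)
open import Function.Bundles using (_⇔_; mk⇔; Equivalence)
open import Function.Definitions using (Injective)
open import Level using (0ℓ)
open import Relation.Binary.Definitions using (tri<; tri≈; tri>)
open import Relation.Binary.PropositionalEquality
  using (_≡_; _≢_; refl; sym; trans; cong; cong₂; subst; subst₂; module ≡-Reasoning)
open import Relation.Nullary using (Dec; does; yes; no; ¬_; contradiction)
open import Relation.Nullary.Decidable using (_×-dec_)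
open import Relation.Unary using (Pred; Decidable)

open Algebra.Properties.CommutativeMonoid.Sum ℕ.+-0-commutativeMonoid
  using (sum; sum-cong-≗; sum-replicate-zero; ∑-distrib-+)

private
  variable
    k l m n N : ℕ

-- Cardinalities of decidable subsets, as sums of indicators.

𝟙 : ∀ {A : Set} → Dec A → ℕ
𝟙 d = if does d then 1 else 0

𝟙-mono : ∀ {A B : Set} (a? : Dec A) (b? : Dec B) → (A → B) → 𝟙 a? ≤ 𝟙 b?
𝟙-mono (no _)  _       _   = z≤n
𝟙-mono (yes _) (yes _) _   = s≤s z≤n
𝟙-mono (yes a) (no ¬b) a→b = contradiction (a→b a) ¬b

𝟙-disjoint : ∀ {A B C : Set} (a? : Dec A) (b? : Dec B) (c? : Dec C) →
             C ⇔ (A ⊎ B) → (A → ¬ B) → 𝟙 c? ≡ 𝟙 a? + 𝟙 b?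
𝟙-disjoint (yes a) (yes b) _       _ a¬b = contradiction b (a¬b a)
𝟙-disjoint (yes a) (no _)  (yes _) _ _   = refl
𝟙-disjoint (yes a) (no _)  (no ¬c) e _   = contradiction (Equivalence.from e (inj₁ a)) ¬c
𝟙-disjoint (no _)  (yes b) (yes _) _ _   = refl
𝟙-disjoint (no _)  (yes b) (no ¬c) e _   = contradiction (Equivalence.from e (inj₂ b)) ¬c
𝟙-disjoint (no ¬a) (no ¬b) (yes c) e _   = contradiction (Equivalence.to e c) Sum.[ ¬a , ¬b ]
𝟙-disjoint (no _)  (no _)  (no _)  _ _   = refl

count : ∀ {Q : Pred (Fin n) 0ℓ} → Decidable Q → ℕ
count Q? = sum (𝟙 ∘ Q?)

count-disjoint : ∀ {Q R S : Pred (Fin n) 0ℓ}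
                 (Q? : Decidable Q) (R? : Decidable R) (S? : Decidable S) →
                 (∀ x → S x ⇔ (Q x ⊎ R x)) → (∀ x → Q x → ¬ R x) →
                 count S? ≡ count Q? + count R?
count-disjoint Q? R? S? S⇔Q⊎R Q¬R = trans
  (sum-cong-≗ λ x → 𝟙-disjoint (Q? x) (R? x) (S? x) (S⇔Q⊎R x) (Q¬R x))
  (∑-distrib-+ (𝟙 ∘ Q?) (𝟙 ∘ R?))

count-mono : ∀ {Q R : Pred (Fin n) 0ℓ} (Q? : Decidable Q) (R? : Decidable R) →
             (∀ x → Q x → R x) → count Q? ≤ count R?
count-mono {zero}  Q? R? Q⊆R = z≤n
count-mono {suc n} Q? R? Q⊆R = ℕ.+-mono-≤ (𝟙-mono (Q? zero) (R? zero) (Q⊆R zero))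
  (count-mono (Q? ∘ suc) (R? ∘ suc) (Q⊆R ∘ suc))

count-cong : ∀ {Q R : Pred (Fin n) 0ℓ} (Q? : Decidable Q) (R? : Decidable R) →
             (∀ x → Q x → R x) → (∀ x → R x → Q x) → count Q? ≡ count R?
count-cong Q? R? Q⊆R R⊆Q = ℕ.≤-antisym (count-mono Q? R? Q⊆R) (count-mono R? Q? R⊆Q)

count≤n : ∀ {Q : Pred (Fin n) 0ℓ} (Q? : Decidable Q) → count Q? ≤ n
count≤n {zero}  Q? = z≤n
count≤n {suc n} Q? with Q? zero
... | yes _ = s≤s (count≤n (Q? ∘ suc))
... | no  _ = ℕ.m≤n⇒m≤1+n (count≤n (Q? ∘ suc))

count-≟ : ∀ (a : Fin n) → count (Fin._≟ a) ≡ 1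
count-≟ {suc n} zero    = cong suc (sum-replicate-zero n)
count-≟         (suc a) = count-≟ a

-- Counting the values of a function below a bound.

#< : (Fin n → ℕ) → ℕ → ℕ
#< f i = count λ b → f b ℕ.<? i

between? : ∀ (f : Fin n → ℕ) i j → Decidable λ b → i < f b × f b < j
between? f i j b = (i ℕ.<? f b) ×-dec (f b ℕ.<? j)

module _ {f : Fin n → ℕ} (f-inj : Injective _≡_ _≡_ f) where

  -- Cut the values below `i` at `f a`. By injectivity only `a` attains the value `f a`, which
  -- accounts for the successor.
  #<-split : ∀ {a i} → f a < i → #< f i ≡ suc (#< f (f a)) + count (between? f (f a) i)
  #<-split {a} {i} fa<i = begin
    #< f i
      ≡⟨ count-disjoint (λ b → f b ℕ.≤? f a) (between? f (f a) i) (λ b → f b ℕ.<? i)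
           (λ b → mk⇔ (above b) Sum.[ (λ fb≤fa → ℕ.≤-<-trans fb≤fa fa<i) , proj₂ ])
           (λ b fb≤fa (fa<fb , _) → ℕ.<⇒≱ fa<fb fb≤fa) ⟩
    count (λ b → f b ℕ.≤? f a) + count (between? f (f a) i)
      ≡⟨ cong (_+ count (between? f (f a) i))
           (count-disjoint (Fin._≟ a) (λ b → f b ℕ.<? f a) (λ b → f b ℕ.≤? f a)
             (λ b → mk⇔ (equal b) Sum.[ (λ { refl → ℕ.≤-refl }) , ℕ.<⇒≤ ])
             (λ { b refl → ℕ.<-irrefl refl })) ⟩
    count (Fin._≟ a) + #< f (f a) + count (between? f (f a) i)
      ≡⟨ cong (λ c → c + #< f (f a) + count (between? f (f a) i)) (count-≟ a) ⟩
    suc (#< f (f a)) + count (between? f (f a) i) ∎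
    where
    open ≡-Reasoning
    above : ∀ b → f b < i → f b ≤ f a ⊎ (f a < f b × f b < i)
    above b fb<i with f b ℕ.≤? f a
    ... | yes fb≤fa = inj₁ fb≤fa
    ... | no  fb≰fa = inj₂ (ℕ.≰⇒> fb≰fa , fb<i)
    equal : ∀ b → f b ≤ f a → b ≡ a ⊎ f b < f a
    equal b fb≤fa with f b ℕ.≟ f a
    ... | yes fb≡fa = inj₁ (f-inj fb≡fa)
    ... | no  fb≢fa = inj₂ (ℕ.≤∧≢⇒< fb≤fa fb≢fa)

  #<-strict : ∀ {a i} → f a < i → #< f (f a) < #< f i
  #<-strict fa<i = subst (_ <_) (sym (#<-split fa<i)) (ℕ.m≤m+n _ _)

-- Permutations from injective self-maps, and their inverses.

-- Pigeonhole: if `y` were missed, punching it out would embed `Fin (suc n)` in `Fin n`.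
injective⇒strictlySurjective : ∀ {f : Fin n → Fin n} → Injective _≡_ _≡_ f →
                               ∀ y → ∃ λ x → f x ≡ y
injective⇒strictlySurjective {suc n} {f} f-inj y with Fin.any? (λ x → f x Fin.≟ y)
... | yes p = p
... | no ∄x = contradiction
  (Fin.injective⇒≤ {f = λ x → punchOut (y≢f x)}
    λ {a} {b} e → f-inj (Fin.punchOut-injective (y≢f a) (y≢f b) e))
  ℕ.1+n≰n
  where
  y≢f : ∀ x → y ≢ f x
  y≢f x y≡fx = ∄x (x , sym y≡fx)

fromInjective : ∀ (f : Fin n → Fin n) → Injective _≡_ _≡_ f → Permutation′ n
fromInjective f f-inj = permutation f (proj₁ ∘ f⁻¹) (proj₂ ∘ f⁻¹)
  λ x → f-inj (proj₂ (f⁻¹ (f x)))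
  where f⁻¹ = injective⇒strictlySurjective f-inj

-- Equality of permutations compares the forward maps only, so agreement of the inverses has to be
-- derived.
flip-cong : ∀ {π ρ : Permutation′ n} → π Perm.≈ ρ → flip π Perm.≈ flip ρ
flip-cong {π = π} {ρ} e j = begin
  π ⟨$⟩ˡ j                   ≡⟨ cong (π ⟨$⟩ˡ_) (Perm.inverseʳ ρ) ⟨
  π ⟨$⟩ˡ (ρ ⟨$⟩ʳ (ρ ⟨$⟩ˡ j)) ≡⟨ cong (π ⟨$⟩ˡ_) (e (ρ ⟨$⟩ˡ j)) ⟨
  π ⟨$⟩ˡ (π ⟨$⟩ʳ (ρ ⟨$⟩ˡ j)) ≡⟨ Perm.inverseˡ π ⟩
  ρ ⟨$⟩ˡ j                   ∎
  where open ≡-Reasoning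

-- Standardisation of an injection.

toℕ∘-injective : ∀ (f : Fin n → Fin N) → Injective _≡_ _≡_ f → Injective _≡_ _≡_ (toℕ ∘ f)
toℕ∘-injective f f-inj eq = f-inj (Fin.toℕ-injective eq)

module _ (f : Fin n → Fin N) (f-inj : Injective _≡_ _≡_ f) where

  private
    toℕ∘f-inj : Injective _≡_ _≡_ (toℕ ∘ f)
    toℕ∘f-inj = toℕ∘-injective f f-inj

    rank<n : ∀ a → #< (toℕ ∘ f) (toℕ (f a)) < n
    -- Raising the bound by one makes `a` itself count, so the rank is strictly below a count that
    -- is at most `n`.
    rank<n a = ℕ.<-≤-trans (#<-strict toℕ∘f-inj (ℕ.n<1+n (toℕ (f a))))
      (count≤n λ b → toℕ (f b) ℕ.<? suc (toℕ (f a)))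

  -- The standardisation of `f`: the permutation of `Fin n` in the same relative order as the values
  -- of `f`.
  rank : Fin n → Fin n
  rank a = fromℕ< (rank<n a)

  toℕ-rank : ∀ a → toℕ (rank a) ≡ #< (toℕ ∘ f) (toℕ (f a))
  toℕ-rank a = Fin.toℕ-fromℕ< (rank<n a)

  rank-mono-< : ∀ {a b} → toℕ (f a) < toℕ (f b) → toℕ (rank a) < toℕ (rank b)
  rank-mono-< {a} {b} lt = subst₂ _<_ (sym (toℕ-rank a)) (sym (toℕ-rank b))
    (#<-strict toℕ∘f-inj lt)

  rank-injective : Injective _≡_ _≡_ rank
  rank-injective {a} {b} e with ℕ.<-cmp (toℕ (f a)) (toℕ (f b))
  ... | tri< lt _ _ = contradiction (cong toℕ e) (ℕ.<⇒≢ (rank-mono-< lt))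
  ... | tri≈ _ eq _ = toℕ∘f-inj eq
  ... | tri> _ _ gt = contradiction (cong toℕ (sym e)) (ℕ.<⇒≢ (rank-mono-< gt))

  ranking : Permutation′ n
  ranking = fromInjective rank rank-injective

-- Ranks are counts that involve only the values, so the two proofs of injectivity may differ. This
-- makes `subword` respect equality of vertices.
ranking-cong : ∀ (f g : Fin n → Fin N) (f-inj : Injective _≡_ _≡_ f) (g-inj : Injective _≡_ _≡_ g) →
               (∀ a → f a ≡ g a) →
               ranking f f-inj Perm.≈ ranking g g-inj
ranking-cong f g f-inj g-inj e a = Fin.toℕ-injective (begin
  toℕ (rank f f-inj a)        ≡⟨ toℕ-rank f f-inj a ⟩
  #< (toℕ ∘ f) (toℕ (f a))
    ≡⟨ count-cong (λ b → toℕ (f b) ℕ.<? toℕ (f a)) (λ b → toℕ (g b) ℕ.<? toℕ (g a))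
         (λ b → subst₂ _<_ (cong toℕ (e b)) (cong toℕ (e a)))
         (λ b → subst₂ _<_ (cong toℕ (sym (e b))) (cong toℕ (sym (e a)))) ⟩
  #< (toℕ ∘ g) (toℕ (g a))    ≡⟨ toℕ-rank g g-inj a ⟨
  toℕ (rank g g-inj a)        ∎)
  where open ≡-Reasoning

-- Values of a prefix reversal.

toℕ-reversePrefix-< : ∀ i .(i≤n : i ≤ n) j → toℕ j < i →
                      toℕ (reversePrefix i i≤n j) ≡ i ∸ suc (toℕ j)
toℕ-reversePrefix-< i i≤n j j<i with toℕ j ℕ.<? i
... | no  ≮  = contradiction j<i ≮
... | yes lt = begin
  toℕ (inject≤ (opposite (fromℕ< lt)) i≤n) ≡⟨ Fin.toℕ-inject≤ (opposite (fromℕ< lt)) i≤n ⟩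
  toℕ (opposite (fromℕ< lt))               ≡⟨ Fin.opposite-prop (fromℕ< lt) ⟩
  i ∸ suc (toℕ (fromℕ< lt))                ≡⟨ cong (λ x → i ∸ suc x) (Fin.toℕ-fromℕ< lt) ⟩
  i ∸ suc (toℕ j)                          ∎
  where open ≡-Reasoning

reversePrefix-≥ : ∀ i .(i≤n : i ≤ n) j → i ≤ toℕ j → reversePrefix i i≤n j ≡ j
reversePrefix-≥ i i≤n j i≤j with toℕ j ℕ.<? i
... | yes lt = contradiction i≤j (ℕ.<⇒≱ lt)
... | no  _  = refl

toℕ-reversePrefix<i : ∀ i .(i≤n : i ≤ n) j → toℕ j < i → toℕ (reversePrefix i i≤n j) < i
toℕ-reversePrefix<i (suc i) i≤n j j<i =
  subst (_< suc i) (sym (toℕ-reversePrefix-< (suc i) i≤n j j<i)) (s≤s (ℕ.m∸n≤m i (toℕ j)))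

-- The effect of a prefix reversal on ranks.

module _ {f g : Fin n → Fin N} (f-inj : Injective _≡_ _≡_ f) (g-inj : Injective _≡_ _≡_ g)
         (i : ℕ) (i≤N : i ≤ N) (g≡r∘f : ∀ a → g a ≡ reversePrefix i i≤N (f a)) where

  private
    f′ g′ : Fin n → ℕ
    f′ = toℕ ∘ f
    g′ = toℕ ∘ g

    g-< : ∀ {a} → f′ a < i → g′ a ≡ i ∸ suc (f′ a)
    g-< {a} lt = trans (cong toℕ (g≡r∘f a)) (toℕ-reversePrefix-< i i≤N (f a) lt)

    g<i : ∀ {a} → f′ a < i → g′ a < i
    g<i {a} lt = subst (_< i) (cong toℕ (sym (g≡r∘f a))) (toℕ-reversePrefix<i i i≤N (f a) lt)

    g-≥ : ∀ {a} → i ≤ f′ a → g′ a ≡ f′ a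
    g-≥ {a} ge = cong toℕ (trans (g≡r∘f a) (reversePrefix-≥ i i≤N (f a) ge))

  -- The length of the prefix reversal that the reversal of length `i` induces on ranks.
  prefixCount : ℕ
  prefixCount = #< f′ i

  prefixCount≤n : prefixCount ≤ n
  prefixCount≤n = count≤n λ b → f′ b ℕ.<? i

  private
    -- Inside the prefix the reversal inverts the order, while values outside stay at least `i`. So
    -- what comes to lie below `g a` is exactly what lay between `f a` and `i`.
    #<g-inside : ∀ {a} → f′ a < i → #< g′ (g′ a) ≡ count (between? f′ (f′ a) i)
    #<g-inside {a} fa<i = count-cong (λ b → g′ b ℕ.<? g′ a) (between? f′ (f′ a) i) to from
      where
      to : ∀ b → g′ b < g′ a → f′ a < f′ b × f′ b < i
      to b gb<ga with f′ b ℕ.<? i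
      ... | no ≮ = contradiction (ℕ.<-trans gb<ga (g<i fa<i))
        (ℕ.≤⇒≯ (subst (i ≤_) (sym (g-≥ (ℕ.≮⇒≥ ≮))) (ℕ.≮⇒≥ ≮)))
      ... | yes fb<i = ℕ.≰⇒> (λ fb≤fa → ℕ.<⇒≱ (subst₂ _<_ (g-< fb<i) (g-< fa<i) gb<ga)
                                  (ℕ.∸-monoʳ-≤ i (s≤s fb≤fa)))
                     , fb<i
      from : ∀ b → f′ a < f′ b × f′ b < i → g′ b < g′ a
      from b (fa<fb , fb<i) = subst₂ _<_ (sym (g-< fb<i)) (sym (g-< fa<i))
        (ℕ.∸-monoʳ-< (s≤s fa<fb) fb<i)

    -- The reversal keeps values below `i` below `i` and fixes all others, so the same arguments lie
    -- below `a` before and after.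
    #<g-outside : ∀ {a} → i ≤ f′ a → #< g′ (g′ a) ≡ #< f′ (f′ a)
    #<g-outside {a} i≤fa = count-cong (λ b → g′ b ℕ.<? g′ a) (λ b → f′ b ℕ.<? f′ a) to from
      where
      to : ∀ b → g′ b < g′ a → f′ b < f′ a
      to b gb<ga with f′ b ℕ.<? i
      ... | yes fb<i = ℕ.<-≤-trans fb<i i≤fa
      ... | no  ≮    = subst₂ _<_ (g-≥ (ℕ.≮⇒≥ ≮)) (g-≥ i≤fa) gb<ga
      from : ∀ b → f′ b < f′ a → g′ b < g′ a
      from b fb<fa with f′ b ℕ.<? i
      ... | yes fb<i = ℕ.<-≤-trans (g<i fb<i) (subst (i ≤_) (sym (g-≥ i≤fa)) i≤fa)
      ... | no  ≮    = subst₂ _<_ (sym (g-≥ (ℕ.≮⇒≥ ≮))) (sym (g-≥ i≤fa)) fb<fa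

  -- By `#<-split`, for `f a` inside the prefix `prefixCount` is the successor of the old rank plus
  -- the count strictly between, and that count is the new rank. Outside, the whole prefix lies
  -- below `f a`, so the rank is at least `prefixCount` and stays fixed.
  rank-reversePrefix : ∀ a → rank g g-inj a ≡
                       reversePrefix prefixCount prefixCount≤n (rank f f-inj a)
  rank-reversePrefix a with f′ a ℕ.<? i
  ... | yes fa<i = Fin.toℕ-injective (begin
    toℕ (rank g g-inj a)                     ≡⟨ toℕ-rank g g-inj a ⟩
    #< g′ (g′ a)                             ≡⟨ #<g-inside fa<i ⟩
    c                                        ≡⟨ ℕ.m+n∸m≡n (suc (#< f′ (f′ a))) c ⟨
    suc (#< f′ (f′ a)) + c ∸ suc (#< f′ (f′ a))
      ≡⟨ cong₂ (λ x y → x ∸ suc y)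
           (#<-split (toℕ∘-injective f f-inj) fa<i) (toℕ-rank f f-inj a) ⟨
    prefixCount ∸ suc (toℕ (rank f f-inj a))
      ≡⟨ toℕ-reversePrefix-< prefixCount prefixCount≤n (rank f f-inj a)
           (subst (_< prefixCount) (sym (toℕ-rank f f-inj a))
             (#<-strict (toℕ∘-injective f f-inj) fa<i)) ⟨
    toℕ (reversePrefix prefixCount prefixCount≤n (rank f f-inj a)) ∎)
    where
    open ≡-Reasoning
    c = count (between? f′ (f′ a) i)
  ... | no ≮ = trans
    (Fin.toℕ-injective (begin
      toℕ (rank g g-inj a) ≡⟨ toℕ-rank g g-inj a ⟩
      #< g′ (g′ a)         ≡⟨ #<g-outside (ℕ.≮⇒≥ ≮) ⟩
      #< f′ (f′ a)         ≡⟨ toℕ-rank f f-inj a ⟨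
      toℕ (rank f f-inj a) ∎))
    (sym (reversePrefix-≥ prefixCount prefixCount≤n (rank f f-inj a)
      (subst (prefixCount ≤_) (sym (toℕ-rank f f-inj a))
        (count-mono (λ b → f′ b ℕ.<? i) (λ b → f′ b ℕ.<? f′ a)
          λ b fb<i → ℕ.<-≤-trans fb<i (ℕ.≮⇒≥ ≮)))))
    where open ≡-Reasoning

  -- A ranking sends letters to positions, a vertex sends positions to letters. Inversion turns the
  -- reversal applied after the ranking into the right multiplication of the Pancake graph.
  ranking-adj : ∀ {a b} → f′ a < f′ b → f′ b < i →
                PancakeAdj (flip (ranking f f-inj)) (flip (ranking g g-inj))
  ranking-adj {a} {b} fa<fb fb<i = prefixCount
    -- The counts below `f a`, below `f b` and below `i` strictly increase, so the last is at least
    -- 2.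
    , ℕ.≤-<-trans (ℕ.≤-<-trans z≤n (#<-strict inj fa<fb)) (#<-strict inj fb<i)
    , prefixCount≤n , λ j → begin
      ρg ⟨$⟩ˡ j
        ≡⟨ Perm.inverseˡ ρf ⟨
      ρf ⟨$⟩ˡ (ρf ⟨$⟩ʳ (ρg ⟨$⟩ˡ j))
        -- Insert the reversal twice: the inner copy turns `ρf` into `ρg`, which then cancels.
        ≡⟨ cong (ρf ⟨$⟩ˡ_) (reversePrefix-involutive prefixCount prefixCount≤n _) ⟨
      ρf ⟨$⟩ˡ r (r (ρf ⟨$⟩ʳ (ρg ⟨$⟩ˡ j)))
        ≡⟨ cong (λ x → ρf ⟨$⟩ˡ r x) (rank-reversePrefix (ρg ⟨$⟩ˡ j)) ⟨
      ρf ⟨$⟩ˡ r (ρg ⟨$⟩ʳ (ρg ⟨$⟩ˡ j))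
        ≡⟨ cong (λ x → ρf ⟨$⟩ˡ r x) (Perm.inverseʳ ρg) ⟩
      ρf ⟨$⟩ˡ r j ∎
    where
    open ≡-Reasoning
    inj : Injective _≡_ _≡_ f′
    inj = toℕ∘-injective f f-inj
    ρf = ranking f f-inj
    ρg = ranking g g-inj
    r = reversePrefix prefixCount prefixCount≤n

-- Subwords of a permutation.

-- The word of the letters in the image of e, in the order in which they occur in
-- π: its inverse sends a letter a to the rank of the position of e a.
module _ {e : Fin n → Fin N} (e-inj : Injective _≡_ _≡_ e) where

  position : Permutation′ N → Fin n → Fin N
  position π a = π ⟨$⟩ˡ e a

  position-injective : ∀ π → Injective _≡_ _≡_ (position π)
  position-injective π {a} {b} eq = e-inj (begin
    e a                   ≡⟨ Perm.inverseʳ π ⟨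
    π ⟨$⟩ʳ position π a   ≡⟨ cong (π ⟨$⟩ʳ_) eq ⟩
    π ⟨$⟩ʳ position π b   ≡⟨ Perm.inverseʳ π ⟩
    e b                   ∎)
    where open ≡-Reasoning

  subword : Permutation′ N → Permutation′ n
  subword π = flip (ranking (position π) (position-injective π))

  subword-cong : ∀ {π σ} → π Perm.≈ σ → subword π Perm.≈ subword σ
  subword-cong {π} {σ} π≈σ = flip-cong
    {π = ranking (position π) (position-injective π)}
    {ρ = ranking (position σ) (position-injective σ)}
    (ranking-cong (position π) (position σ) (position-injective π) (position-injective σ)
      λ a → flip-cong {π = π} {ρ = σ} π≈σ (e a))

module _ {e : Fin n → Fin (suc N)} (e-inj : Injective _≡_ _≡_ e) where

  -- The letter `b` heading `σ` stands at the end of the reversed prefix of `π`, and `a` at its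
  -- start, so the positions of `a` and `b` in `π` are the two that `ranking-adj` asks for.
  subword-adj : ∀ {π σ} → PancakeAdj π σ → ∀ {a b} →
                e a ≡ π ⟨$⟩ʳ zero → e b ≡ σ ⟨$⟩ʳ zero →
                PancakeAdj (subword e-inj π) (subword e-inj σ)
  subword-adj {π} {σ} (suc (suc i) , 2≤i , i≤N , σ≈πr) {a} {b} ea≡π0 eb≡σ0 = ranking-adj
    (position-injective e-inj π) (position-injective e-inj σ) (suc (suc i)) i≤N
    -- A prefix reversal is its own inverse, so positions in `σ` are the reversed positions in `π`.
    (λ c → flip-cong {π = σ} {ρ = π ∙ prefixReversal (suc (suc i)) i≤N} σ≈πr (e c))
    (subst₂ _<_ (cong toℕ (sym fa)) (sym fb) (s≤s z≤n))
    (subst (_< suc (suc i)) (sym fb) ℕ.≤-refl)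
    where
    fa : position e-inj π a ≡ zero
    fa = trans (cong (π ⟨$⟩ˡ_) ea≡π0) (Perm.inverseˡ π)
    fb : toℕ (position e-inj π b) ≡ suc i
    fb = trans
      (cong toℕ (trans (cong (π ⟨$⟩ˡ_) (trans eb≡σ0 (σ≈πr zero))) (Perm.inverseˡ π)))
      (toℕ-reversePrefix-< (suc (suc i)) i≤N zero (s≤s z≤n))
  subword-adj (suc zero , s≤s () , _)

-- Combining the two colourings.

join-injective : ∀ k l → Injective _≡_ _≡_ (join k l)
join-injective k l {x} {y} eq = begin
  x                       ≡⟨ Fin.splitAt-join k l x ⟨
  splitAt k (join k l x)  ≡⟨ cong (splitAt k) eq ⟩
  splitAt k (join k l y)  ≡⟨ Fin.splitAt-join k l y ⟩
  y                       ∎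
  where open ≡-Reasoning

-- The explicit successor provides the first position `zero` at which the head is read.
splitColouring : Colouring (P (suc n)) k → Colouring (P m) l → Colouring (P (suc n + m)) (k + l)
splitColouring {n} {k} {m} {l} C D = record
  { colour = record { to = colourOf ; cong = λ {π} {σ} → colourOf-cong {π} {σ} }
  ; proper = λ {π} {σ} adj →
      classify-proper (head π) (head σ) {π} {σ} refl refl adj ∘ join-injective k l
  }
  where
  module C = Colouring C
  module D = Colouring D

  small-inj : Injective _≡_ _≡_ (_↑ˡ m)
  small-inj = Fin.↑ˡ-injective m _ _
  large-inj : Injective _≡_ _≡_ (suc n ↑ʳ_)
  large-inj = Fin.↑ʳ-injective (suc n) _ _

  small : Permutation′ (suc n + m) → Permutation′ (suc n)
  small = subword small-inj
  large : Permutation′ (suc n + m) → Permutation′ m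
  large = subword large-inj

  head : Permutation′ (suc n + m) → Fin (suc n) ⊎ Fin m
  head π = splitAt (suc n) (π ⟨$⟩ʳ zero)

  -- The class of the head is a separate argument, so that properness can be proved by cases on the
  -- classes of both ends of an edge.
  classify : Fin (suc n) ⊎ Fin m → Permutation′ (suc n + m) → Fin k ⊎ Fin l
  classify (inj₁ _) π = inj₁ (C.colourOf (small π))
  classify (inj₂ _) π = inj₂ (D.colourOf (large π))

  classify-cong : ∀ x {π σ} → π Perm.≈ σ → classify x π ≡ classify x σ
  classify-cong (inj₁ _) {π} {σ} π≈σ =
    cong inj₁ (C.colourOf-cong {small π} {small σ} (subword-cong small-inj {π} {σ} π≈σ))
  classify-cong (inj₂ _) {π} {σ} π≈σ =
    cong inj₂ (D.colourOf-cong {large π} {large σ} (subword-cong large-inj {π} {σ} π≈σ))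

  classify-proper : ∀ x y {π σ} → head π ≡ x → head σ ≡ y →
                    PancakeAdj π σ → classify x π ≢ classify y σ
  classify-proper (inj₁ _) (inj₁ _) {π} {σ} πx σy adj =
    C.proper {small π} {small σ}
      (subword-adj small-inj {π} {σ} adj (Fin.splitAt⁻¹-↑ˡ πx) (Fin.splitAt⁻¹-↑ˡ σy))
    ∘ inj₁-injective
  classify-proper (inj₁ _) (inj₂ _) _ _ _ ()
  classify-proper (inj₂ _) (inj₁ _) _ _ _ ()
  classify-proper (inj₂ _) (inj₂ _) {π} {σ} πx σy adj =
    D.proper {large π} {large σ}
      (subword-adj large-inj {π} {σ} adj (Fin.splitAt⁻¹-↑ʳ πx) (Fin.splitAt⁻¹-↑ʳ σy))
    ∘ inj₂-injective

  colourOf : Permutation′ (suc n + m) → Fin (k + l)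
  colourOf π = join k l (classify (head π) π)

  colourOf-cong : ∀ {π σ} → π Perm.≈ σ → colourOf π ≡ colourOf σ
  colourOf-cong {π} {σ} π≈σ = cong (join k l) (trans
    (classify-cong (head π) {π} {σ} π≈σ)
    (cong (λ i → classify (splitAt (suc n) i) σ) (π≈σ zero)))

χ-colouring : ∀ G → Colouring G (χ G)
χ-colouring G = proj₁ (χ-isChromaticNumber G)

χ-minimal : ∀ G j → Colouring G j → χ G ≤ j
χ-minimal G = proj₂ (χ-isChromaticNumber G)

theorem2 : ∀ (n m : ℕ) .{{_ : NonZero n}} .{{_ : NonZero m}} →
    χ (P (n + m)) ≤ χ (P n) + χ (P m)
theorem2 (suc n) m = χ-minimal (P (suc n + m)) (χ (P (suc n)) + χ (P m))
  (splitColouring {n} {χ (P (suc n))} {m} {χ (P m)}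
    (χ-colouring (P (suc n))) (χ-colouring (P m)))
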